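{- Let $p<q$ be primes, let $s$ be an even divisor of $p-1$ and $r$ a divisor of $q-1$, let $H(p,s)=\langle a\rangle$, let $t\in\mathbb{Z}_q^*$ be such that $t^{s/2}\in -H(q,r)$, let $u=\mathrm{lcm}(r,o(t))$, and let $G(pq;r,s,u)$ be the graph defined by these data. Then $G(p,s)\times G(q,u)$ is symmetric, and $G(pq;r,s,u)$ is isomorphic to a spanning subgraph of $G(p,s)\times G(q,u)$. Moreover, $G(pq;r,s,u)\cong G(p,s)\times G(q,u)$ if and only if $t\in H(q,r)$.
   Context: For a prime $p$ and a positive divisor $r$ of $p-1$, $H(p,r)$ is the unique subgroup of order $r$ of $\mathbb{Z}_p^*$, and $G(p,r)$ is the circulant graph on $\mathbb{Z}_p$ with $x,y$ adjacent iff $y-x\in H(p,r)$. $o(t)$ is the order of $t$ in $\mathbb{Z}_q^*$. The graph $G(pq;r,s,u)$ has vertex set $\mathbb{Z}_p\times\mathbb{Z}_q$, with $(i,x),(j,y)$ adjacent iff there is an integer $l$ such that $j-i=a^l$ and $y-x\in t^lH(q,r)$. (Here $u$ divides $q-1$, so $G(q,u)$ is well defined.) The categorical product $\Gamma\times\Psi$ has vertex set $V(\Gamma)\times V(\Psi)$ with $(u,x),(v,y)$ adjacent iff $\{u,v\}\in E(\Gamma)$ and $\{x,y\}\in E(\Psi)$. A graph is symmetric if its automorphism group is transitive on vertices and on arcs (ordered pairs of adjacent vertices). -}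

module Defs where

open import Level using (0ℓ)
open import Data.Nat as ℕ using (ℕ; _∸_; NonZero)
open import Data.Nat.DivMod using (_mod_)
open import Data.Integer using (ℤ; +_; -[1+_])
open import Data.Fin using (Fin; toℕ)
open import Data.Fin.Subset using (Subset; _∈_; ∣_∣)
open import Data.Product using (∃-syntax; _×_; _,_)
open import Data.Product.Relation.Binary.Pointwise.NonDependent using (Pointwise)
open import Function.Bundles using (_↔_; _⇔_; Inverse)
open import Relation.Binary.Core using (Rel; _⇒_)
open import Relation.Binary.Definitions using (Symmetric; Irreflexive)
open import Relation.Binary.PropositionalEquality using (_≡_)
open import Relation.Unary using (Pred)

-- ℤ_n is Fin n, with arithmetic on representatives reduced modulo n.

module _ {n : ℕ} .{{_ : NonZero n}} where

  infixl 6 _+_ _-_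
  infixl 7 _*_
  infixr 8 _^_ _^ᶻ_
  infix  9 -_

  1# : Fin n
  1# = 1 mod n

  _+_ _*_ : Fin n → Fin n → Fin n
  x + y = (toℕ x ℕ.+ toℕ y) mod n
  x * y = (toℕ x ℕ.* toℕ y) mod n

  -_ : Fin n → Fin n
  - x = (n ∸ toℕ x) mod n

  _-_ : Fin n → Fin n → Fin n
  x - y = x + (- y)

  _^_ : Fin n → ℕ → Fin n
  x ^ k = (toℕ x ℕ.^ k) mod n

  -- The inverse is stored so that integer powers need no search; it is
  -- determined by the value.
  record Units : Set where
    field
      val     : Fin n
      inv     : Fin n
      val*inv : val * inv ≡ 1#

  open Units public

  _^ᶻ_ : Units → ℤ → Fin n
  t ^ᶻ (+ k)    = val t ^ k
  t ^ᶻ -[1+ k ] = inv t ^ ℕ.suc k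

  ⟨_⟩ : Units → Pred (Fin n) 0ℓ
  ⟨ a ⟩ x = ∃[ l ] x ≡ a ^ᶻ l

  IsOrder : Units → ℕ → Set
  IsOrder t k = 0 ℕ.< k × val t ^ k ≡ 1#
              × (∀ m → 0 ℕ.< m → val t ^ m ≡ 1# → k ℕ.≤ m)

  -- A subgroup of ℤ_n^*: closure under inverses forces every element
  -- to be a unit.
  record IsSubgroup (S : Subset n) : Set where
    field
      1∈        : 1# ∈ S
      *-closed  : ∀ {x y} → x ∈ S → y ∈ S → x * y ∈ S
      ⁻¹-closed : ∀ {x} → x ∈ S → ∃[ y ] (y ∈ S × x * y ≡ 1#)

  _·_ : Fin n → Pred (Fin n) 0ℓ → Pred (Fin n) 0ℓ
  (x · P) y = ∃[ h ] (P h × y ≡ x * h)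

  neg : Pred (Fin n) 0ℓ → Pred (Fin n) 0ℓ
  neg P y = ∃[ h ] (P h × y ≡ - h)

-- For n prime and r a divisor of n - 1 there is exactly one subgroup of
-- order r, so lying in it is the same as lying in some such subgroup.
H : (n : ℕ) .{{_ : NonZero n}} → ℕ → Pred (Fin n) 0ℓ
H n r x = ∃[ S ] (IsSubgroup S × ∣ S ∣ ≡ r × x ∈ S)

-- Adjacency relations; IsGraph singles out the simple undirected graphs.
-- (The circulant G p r is only a digraph when r is odd and p > 2.)
Digraph : Set → Set₁
Digraph V = Rel V 0ℓ

IsGraph : {V : Set} → Digraph V → Set
IsGraph Γ = Symmetric Γ × Irreflexive _≡_ Γ

record _≅_ {V W : Set} (Γ : Digraph V) (Δ : Digraph W) : Set where
  field
    bij      : V ↔ W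
  open Inverse bij public using (to; from)
  field
    adjacent : ∀ x y → Γ x y ⇔ Δ (to x) (to y)

infix 4 _≅_

Aut : {V : Set} → Digraph V → Set
Aut Γ = Γ ≅ Γ

record IsSymmetricGraph {V : Set} (Γ : Digraph V) : Set where
  open _≅_ using (to)
  field
    isGraph          : IsGraph Γ
    vertexTransitive : ∀ x y → ∃[ φ ] to {Γ = Γ} {Δ = Γ} φ x ≡ y
    arcTransitive    : ∀ x y x′ y′ → Γ x y → Γ x′ y′ →
                       ∃[ φ ] (to {Γ = Γ} {Δ = Γ} φ x ≡ x′ × to φ y ≡ y′)

IsSpanningSubgraph : {V : Set} → Digraph V → Digraph V → Set
IsSpanningSubgraph Δ Γ = IsGraph Δ × IsGraph Γ × (Δ ⇒ Γ)

infixr 7 _⊗_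

-- The categorical product.
_⊗_ : {V W : Set} → Digraph V → Digraph W → Digraph (V × W)
Γ ⊗ Ψ = Pointwise Γ Ψ

G : (p : ℕ) .{{_ : NonZero p}} → ℕ → Digraph (Fin p)
G p r x y = H p r (y - x)

-- G(pq; r, s, u). The numbers s and u do not occur separately: s enters
-- through the generator a of H(p, s), and u is determined by r and t.
Gpq : (p q : ℕ) .{{_ : NonZero p}} .{{_ : NonZero q}} →
      (r : ℕ) (a : Units {p}) (t : Units {q}) → Digraph (Fin p × Fin q)
Gpq p q r a t (i , x) (j , y) =
  ∃[ l ] (j - i ≡ a ^ᶻ l × ((t ^ᶻ l) · H q r) (y - x))

{-# OPTIONS --safe #-}
module Submission where

-- For n prime and r ∣ n − 1, the group H(n, r) is the set of solutions of xʳ = 1: Lagrange gives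
-- one inclusion, and counting the roots of Xʳ − 1 and of (Xⁿ − X) / (Xʳ − 1) shows that there are
-- exactly r solutions. Hence −1 lies in H(p, s) and H(q, u), affine maps with multipliers in H
-- act on the circulants, and the arcs of G(pq; r, s, u) are arcs of the product.
-- If the two graphs are isomorphic, they have the same arcs, because they share a finite vertex set
-- and one contains the other. The arc (0, 0) → (1, t) of the product then gives l with aˡ = 1 and
-- t ∈ tˡ H(q, r); since a has order s, s ∣ l, and tˢ ∈ H(q, r) yields t ∈ H(q, r).

open import Defs
open import Level using (0ℓ)
open import Algebra.Bundles using (CommutativeRing)
open import Algebra.Properties.CommutativeSemigroup using (interchange; x∙yz≈z∙yx; x∙yz≈y∙xz)
import Algebra.Properties.AbelianGroup as AbelianGroupProperties
import Algebra.Properties.Group as GroupProperties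
import Algebra.Properties.Ring as RingProperties
open import Data.Nat as ℕ using (ℕ; zero; suc; _∸_; _<_; _/_; NonZero)
import Data.Nat.Properties as ℕ
open import Data.Integer as ℤ using (ℤ; -[1+_])
open import Data.Nat.Coprimality using (prime⇒coprime; coprime-Bézout)
open import Data.Nat.DivMod
  using (_mod_; _%_; %-distribˡ-+; %-distribˡ-*; m<n⇒m%n≡m; m%n<n; m≡m%n+[m/n]*n; n%n≡0; m*n%n≡0;
         m/n*n≡m; [m+kn]%n≡m%n)
open import Data.Nat.Divisibility using (_∣_; divides; 0∣⇒≡0; m%n≡0⇒n∣m; m∣m*n; ∣⇒≤)
open import Data.Nat.LCM using (lcm; lcm-least; m∣lcm[m,n]; n∣lcm[m,n])
open import Data.Nat.GCD using (module Bézout)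
open import Data.Nat.GeneralisedArithmetic using (fold; fold-+)
open import Data.Nat.Primality using (Prime; prime⇒nonTrivial)
open import Data.Fin as Fin using (Fin; toℕ; _≟_; combine)
open import Data.Fin.Properties
  using (toℕ-injective; toℕ-fromℕ<; toℕ<n; toℕ≤n; suc-injective; pigeonhole; combine-injective)
open import Data.Fin.Subset using (Subset; _∈_; ∣_∣; ∁; ⁅_⁆; inside; outside)
open import Data.Fin.Subset.Properties
  using (∣∁p∣≡n∸∣p∣; ∣⁅x⁆∣≡1; x∈⁅y⁆⇒x≡y; x∈⁅x⁆; x∈∁p⇒x∉p; x∉p⇒x∈∁p)
open import Data.List as List using (List; []; _∷_; length)
open import Data.List.Membership.Propositional using () renaming (_∈_ to _∈ˡ_)
open import Data.List.Membership.Propositional.Properties using (∈-map⁺; ∈-map⁻)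
open import Data.List.Membership.Propositional.Properties.WithK using (unique∧set⇒bag)
open import Data.List.Properties using (length-map)
open import Data.List.Relation.Binary.BagAndSetEquality using (∼bag⇒↭)
open import Data.List.Relation.Binary.Permutation.Propositional using (_↭_; ↭⇒↭ₛ)
import Data.List.Relation.Binary.Permutation.Setoid.Properties as Permutation
open import Data.List.Relation.Unary.All as All using (All; []; _∷_)
open import Data.List.Relation.Unary.AllPairs using ([]; _∷_)
open import Data.List.Relation.Unary.Any using (here; there)
open import Data.List.Relation.Unary.Unique.Propositional using (Unique)
import Data.List.Relation.Unary.Unique.Propositional.Properties as Unique
open import Data.Product using (∃-syntax; _×_; _,_; proj₁; proj₂)
open import Data.Product.Function.NonDependent.Propositional using (_×-↔_; _×-⇔_)
open import Data.Vec using (Vec; []; _∷_; tabulate; replicate; _++_; here; there)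
open import Data.Vec.Properties using ([]=⇒lookup; lookup⇒[]=; lookup∘tabulate)
open import Function.Base using (_∘_; case_of_; id)
open import Function.Bundles using (_⇔_; mk⇔; mk↔ₛ′; Equivalence; Inverse)
open import Function.Construct.Identity using (↔-id)
open import Relation.Binary.Core using (_⇒_)
open import Relation.Binary.Definitions using (Symmetric; Irreflexive)
open import Relation.Binary.PropositionalEquality
open import Relation.Nullary using (does; yes; no; contradiction)
open import Relation.Nullary.Decidable using (dec-true)
open import Relation.Unary using (Pred; Decidable; _≐_)

-- The ring ℤ_n

module _ {n : ℕ} .{{_ : NonZero n}} where

  private variable
    j k : ℕ
    x y : Fin n

  0# : Fin n
  0# = 0 mod n

  toℕ-mod : ∀ k → toℕ (k mod n) ≡ k % n
  toℕ-mod k = toℕ-fromℕ< (m%n<n k n)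

  mod-cong : j % n ≡ k % n → j mod n ≡ k mod n
  mod-cong {j} {k} eq = toℕ-injective (trans (toℕ-mod j) (trans eq (sym (toℕ-mod k))))

  mod-toℕ : ∀ x → toℕ x mod n ≡ x
  mod-toℕ x = toℕ-injective (trans (toℕ-mod (toℕ x)) (m<n⇒m%n≡m (toℕ<n x)))

  mod-+ : ∀ j k → (j mod n) + (k mod n) ≡ (j ℕ.+ k) mod n
  mod-+ j k = mod-cong (begin
    (toℕ (j mod n) ℕ.+ toℕ (k mod n)) % n ≡⟨ cong₂ (λ a b → (a ℕ.+ b) % n) (toℕ-mod j) (toℕ-mod k) ⟩
    (j % n ℕ.+ k % n) % n                 ≡⟨ %-distribˡ-+ j k n ⟨
    (j ℕ.+ k) % n                         ∎)
    where open ≡-Reasoning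

  mod-* : ∀ j k → (j mod n) * (k mod n) ≡ (j ℕ.* k) mod n
  mod-* j k = mod-cong (begin
    (toℕ (j mod n) ℕ.* toℕ (k mod n)) % n ≡⟨ cong₂ (λ a b → (a ℕ.* b) % n) (toℕ-mod j) (toℕ-mod k) ⟩
    (j % n ℕ.* (k % n)) % n               ≡⟨ %-distribˡ-* j k n ⟨
    (j ℕ.* k) % n                         ∎)
    where open ≡-Reasoning

  mod-+ˡ : ∀ k x → (k mod n) + x ≡ (k ℕ.+ toℕ x) mod n
  mod-+ˡ k x = trans (cong ((k mod n) +_) (sym (mod-toℕ x))) (mod-+ k (toℕ x))

  mod-+ʳ : ∀ x k → x + (k mod n) ≡ (toℕ x ℕ.+ k) mod n
  mod-+ʳ x k = trans (cong (_+ (k mod n)) (sym (mod-toℕ x))) (mod-+ (toℕ x) k)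

  mod-*ˡ : ∀ k x → (k mod n) * x ≡ (k ℕ.* toℕ x) mod n
  mod-*ˡ k x = trans (cong ((k mod n) *_) (sym (mod-toℕ x))) (mod-* k (toℕ x))

  mod-*ʳ : ∀ x k → x * (k mod n) ≡ (toℕ x ℕ.* k) mod n
  mod-*ʳ x k = trans (cong (_* (k mod n)) (sym (mod-toℕ x))) (mod-* (toℕ x) k)

  +-assoc : ∀ x y z → (x + y) + z ≡ x + (y + z)
  +-assoc x y z = begin
    (x + y) + z                         ≡⟨ mod-+ˡ (toℕ x ℕ.+ toℕ y) z ⟩
    (toℕ x ℕ.+ toℕ y ℕ.+ toℕ z) mod n   ≡⟨ cong (_mod n) (ℕ.+-assoc (toℕ x) (toℕ y) (toℕ z)) ⟩
    (toℕ x ℕ.+ (toℕ y ℕ.+ toℕ z)) mod n ≡⟨ mod-+ʳ x (toℕ y ℕ.+ toℕ z) ⟨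
    x + (y + z)                         ∎
    where open ≡-Reasoning

  *-assoc : ∀ x y z → (x * y) * z ≡ x * (y * z)
  *-assoc x y z = begin
    (x * y) * z                         ≡⟨ mod-*ˡ (toℕ x ℕ.* toℕ y) z ⟩
    (toℕ x ℕ.* toℕ y ℕ.* toℕ z) mod n   ≡⟨ cong (_mod n) (ℕ.*-assoc (toℕ x) (toℕ y) (toℕ z)) ⟩
    (toℕ x ℕ.* (toℕ y ℕ.* toℕ z)) mod n ≡⟨ mod-*ʳ x (toℕ y ℕ.* toℕ z) ⟨
    x * (y * z)                         ∎
    where open ≡-Reasoning

  +-comm : ∀ x y → x + y ≡ y + x
  +-comm x y = cong (_mod n) (ℕ.+-comm (toℕ x) (toℕ y))

  *-comm : ∀ x y → x * y ≡ y * x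
  *-comm x y = cong (_mod n) (ℕ.*-comm (toℕ x) (toℕ y))

  +-identityˡ : ∀ x → 0# + x ≡ x
  +-identityˡ x = trans (mod-+ˡ 0 x) (mod-toℕ x)

  *-identityˡ : ∀ x → 1# * x ≡ x
  *-identityˡ x = trans (mod-*ˡ 1 x) (trans (cong (_mod n) (ℕ.*-identityˡ (toℕ x))) (mod-toℕ x))

  *-distribˡ-+ : ∀ x y z → x * (y + z) ≡ x * y + x * z
  *-distribˡ-+ x y z = begin
    x * (y + z)                                   ≡⟨ mod-*ʳ x (toℕ y ℕ.+ toℕ z) ⟩
    (toℕ x ℕ.* (toℕ y ℕ.+ toℕ z)) mod n           ≡⟨ cong (_mod n) (ℕ.*-distribˡ-+ (toℕ x) (toℕ y) (toℕ z)) ⟩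
    (toℕ x ℕ.* toℕ y ℕ.+ toℕ x ℕ.* toℕ z) mod n   ≡⟨ mod-+ (toℕ x ℕ.* toℕ y) (toℕ x ℕ.* toℕ z) ⟨
    x * y + x * z                                 ∎
    where open ≡-Reasoning

  -‿inverseʳ : ∀ x → x + - x ≡ 0#
  -‿inverseʳ x = begin
    x + - x                         ≡⟨ mod-+ʳ x (n ∸ toℕ x) ⟩
    (toℕ x ℕ.+ (n ∸ toℕ x)) mod n   ≡⟨ cong (_mod n) (ℕ.m+[n∸m]≡n (toℕ≤n x)) ⟩
    n mod n                         ≡⟨ mod-cong (trans (n%n≡0 n) (sym (m*n%n≡0 0 n))) ⟩
    0#                              ∎
    where open ≡-Reasoning

  mod-^ : ∀ j k → (j mod n) ^ k ≡ (j ℕ.^ k) mod n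
  mod-^ j zero    = refl
  mod-^ j (suc k) = begin
    (j mod n) ^ suc k               ≡⟨ mod-*ʳ (j mod n) (toℕ (j mod n) ℕ.^ k) ⟨
    (j mod n) * (j mod n) ^ k       ≡⟨ cong ((j mod n) *_) (mod-^ j k) ⟩
    (j mod n) * ((j ℕ.^ k) mod n)   ≡⟨ mod-* j (j ℕ.^ k) ⟩
    (j ℕ.^ suc k) mod n             ∎
    where open ≡-Reasoning

  ^-suc : ∀ x k → x ^ suc k ≡ x * x ^ k
  ^-suc x k = sym (mod-*ʳ x (toℕ x ℕ.^ k))

  ^-identityʳ : ∀ x → x ^ 1 ≡ x
  ^-identityʳ x = trans (cong (_mod n) (ℕ.^-identityʳ (toℕ x))) (mod-toℕ x)

  ^-zeroˡ : ∀ k → 1# ^ k ≡ 1#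
  ^-zeroˡ k = trans (mod-^ 1 k) (cong (_mod n) (ℕ.^-zeroˡ k))

  ^-distribˡ-+-* : ∀ x j k → x ^ (j ℕ.+ k) ≡ x ^ j * x ^ k
  ^-distribˡ-+-* x j k =
    trans (cong (_mod n) (ℕ.^-distribˡ-+-* (toℕ x) j k)) (sym (mod-* (toℕ x ℕ.^ j) (toℕ x ℕ.^ k)))

  ^-*-assoc : ∀ x j k → (x ^ j) ^ k ≡ x ^ (j ℕ.* k)
  ^-*-assoc x j k = trans (mod-^ (toℕ x ℕ.^ j) k) (cong (_mod n) (ℕ.^-*-assoc (toℕ x) j k))

  ∣⇒^≡1 : ∀ x → x ^ j ≡ 1# → j ∣ k → x ^ k ≡ 1#
  ∣⇒^≡1 {j = j} x xʲ≡1 (divides c refl) = begin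
    x ^ (c ℕ.* j) ≡⟨ cong (x ^_) (ℕ.*-comm c j) ⟩
    x ^ (j ℕ.* c) ≡⟨ ^-*-assoc x j c ⟨
    (x ^ j) ^ c   ≡⟨ cong (_^ c) xʲ≡1 ⟩
    1# ^ c        ≡⟨ ^-zeroˡ c ⟩
    1#            ∎
    where open ≡-Reasoning

  ^-^≡1 : ∀ x j k → x ^ k ≡ 1# → (x ^ j) ^ k ≡ 1#
  ^-^≡1 x j k xᵏ≡1 = trans (^-*-assoc x j k) (∣⇒^≡1 x xᵏ≡1 (divides j refl))

  +-*-commutativeRing : CommutativeRing 0ℓ 0ℓ
  +-*-commutativeRing = record
    { isCommutativeRing = record
      { isRing = record
        { +-isAbelianGroup = record
          { isGroup = record
            { isMonoid = record
              { isSemigroup = record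
                { isMagma = record { isEquivalence = isEquivalence ; ∙-cong = cong₂ _+_ }
                ; assoc = +-assoc
                }
              ; identity = +-identityˡ , λ x → trans (+-comm x 0#) (+-identityˡ x)
              }
            ; inverse = (λ x → trans (+-comm (- x) x) (-‿inverseʳ x)) , -‿inverseʳ
            ; ⁻¹-cong = cong (λ x → - x)
            }
          ; comm = +-comm
          }
        ; *-cong = cong₂ _*_
        ; *-assoc = *-assoc
        ; *-identity = *-identityˡ , λ x → trans (*-comm x 1#) (*-identityˡ x)
        ; distrib = *-distribˡ-+ , λ x y z →
            trans (*-comm (y + z) x) (trans (*-distribˡ-+ x y z) (cong₂ _+_ (*-comm x y) (*-comm x z)))
        }
      ; *-comm = *-comm
      }
    }

  private module R = CommutativeRing +-*-commutativeRing
  open R public using (*-identityʳ; +-identityʳ; zeroˡ; zeroʳ)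
  open AbelianGroupProperties R.+-abelianGroup public
    using () renaming (⁻¹-anti-homo‿- to -‿anti-homo‿-)
  open GroupProperties R.+-group public
    using () renaming
      ( //-rightDividesˡ to [x-y]+y≡x; //-rightDividesʳ to [x+y]-y≡x; ε⁻¹≈ε to -0≡0; ⁻¹-involutive to -‿involutive
      ; inverseˡ-unique to +≡0⇒≡-; ∙-cancelʳ to +-cancelʳ
      ; ⁻¹-anti-homo-∙ to -‿anti-homo-+)
  open RingProperties R.ring public using (-1*x≈-x; -‿distribˡ-*; -‿distribʳ-*)

  ^-distribʳ-* : ∀ k x y → (x * y) ^ k ≡ x ^ k * y ^ k
  ^-distribʳ-* zero    x y = sym (*-identityˡ 1#)
  ^-distribʳ-* (suc k) x y = begin
    (x * y) ^ suc k           ≡⟨ ^-suc (x * y) k ⟩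
    x * y * (x * y) ^ k       ≡⟨ cong (x * y *_) (^-distribʳ-* k x y) ⟩
    x * y * (x ^ k * y ^ k)   ≡⟨ interchange R.*-commutativeSemigroup x y (x ^ k) (y ^ k) ⟩
    x * x ^ k * (y * y ^ k)   ≡⟨ cong₂ _*_ (^-suc x k) (^-suc y k) ⟨
    x ^ suc k * y ^ suc k     ∎
    where open ≡-Reasoning

  *-^≡1 : ∀ k x y → x ^ k ≡ 1# → y ^ k ≡ 1# → (x * y) ^ k ≡ 1#
  *-^≡1 k x y xᵏ≡1 yᵏ≡1 = trans (^-distribʳ-* k x y) (trans (cong₂ _*_ xᵏ≡1 yᵏ≡1) (*-identityˡ 1#))

  *-leftInverse : ∀ x y z → x * y ≡ 1# → x * (y * z) ≡ z
  *-leftInverse x y z xy≡1 = begin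
    x * (y * z)   ≡⟨ *-assoc x y z ⟨
    x * y * z     ≡⟨ cong (_* z) xy≡1 ⟩
    1# * z        ≡⟨ *-identityˡ z ⟩
    z             ∎
    where open ≡-Reasoning

  *-cancelˡ-invertible : ∀ x y z w → x * y ≡ 1# → x * z ≡ x * w → z ≡ w
  *-cancelˡ-invertible x y z w xy≡1 eq =
    trans (sym (*-leftInverse y x z yx≡1)) (trans (cong (y *_) eq) (*-leftInverse y x w yx≡1))
    where yx≡1 = trans (*-comm y x) xy≡1

  -- Roots of unity get their inverse as a power, so the inverse is again a root of unity by
  -- `^-^≡1`.
  ^-inverse : ∀ k .{{_ : NonZero k}} (x : Fin n) → x ^ k ≡ 1# → x * x ^ (k ∸ 1) ≡ 1#
  ^-inverse (suc k) x xᵏ≡1 = trans (sym (^-suc x k)) xᵏ≡1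

-- Lagrange's theorem

-- Listing a subset turns multiplication by one of its elements into a permutation of a list, under
-- which a product is unchanged.
elements : ∀ {n} → Subset n → List (Fin n)
elements []            = []
elements (inside ∷ S)  = Fin.zero ∷ List.map Fin.suc (elements S)
elements (outside ∷ S) = List.map Fin.suc (elements S)

length-elements : ∀ {n} (S : Subset n) → length (elements S) ≡ ∣ S ∣
length-elements []            = refl
length-elements (inside ∷ S)  = cong suc (trans (length-map Fin.suc (elements S)) (length-elements S))
length-elements (outside ∷ S) = trans (length-map Fin.suc (elements S)) (length-elements S)

∈-elements⁺ : ∀ {n} {S : Subset n} {x} → x ∈ S → x ∈ˡ elements S
∈-elements⁺ {S = inside ∷ _}  here        = here refl
∈-elements⁺ {S = inside ∷ _}  (there x∈S) = there (∈-map⁺ Fin.suc (∈-elements⁺ x∈S))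
∈-elements⁺ {S = outside ∷ _} (there x∈S) = ∈-map⁺ Fin.suc (∈-elements⁺ x∈S)

∈-elements⁻ : ∀ {n} (S : Subset n) {x} → x ∈ˡ elements S → x ∈ S
∈-elements⁻ (inside ∷ S)  (here refl) = here
∈-elements⁻ (inside ∷ S)  (there x∈)  with y , y∈ , refl ← ∈-map⁻ Fin.suc x∈ = there (∈-elements⁻ S y∈)
∈-elements⁻ (outside ∷ S) x∈          with y , y∈ , refl ← ∈-map⁻ Fin.suc x∈ = there (∈-elements⁻ S y∈)

elements-unique : ∀ {n} (S : Subset n) → Unique (elements S)
elements-unique []            = []
elements-unique (inside ∷ S)  =
  All.tabulate (λ x∈ 0≡x → case ∈-map⁻ Fin.suc x∈ of λ { (_ , _ , refl) → contradiction 0≡x λ () })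
  ∷ Unique.map⁺ suc-injective (elements-unique S)
elements-unique (outside ∷ S) = Unique.map⁺ suc-injective (elements-unique S)

module _ {n : ℕ} .{{_ : NonZero n}} where

  private module R = CommutativeRing (+-*-commutativeRing {n})

  ∏ : List (Fin n) → Fin n
  ∏ = List.foldr _*_ 1#

  ∏-↭ : ∀ {xs ys} → xs ↭ ys → ∏ xs ≡ ∏ ys
  ∏-↭ xs↭ys = Permutation.foldr-commMonoid (setoid (Fin n))
    R.*-isCommutativeMonoid (↭⇒↭ₛ xs↭ys)

  ∏-map-* : ∀ x ys → ∏ (List.map (x *_) ys) ≡ ∏ ys * x ^ length ys
  ∏-map-* x []       = sym (*-identityˡ 1#)
  ∏-map-* x (y ∷ ys) = begin
    x * y * ∏ (List.map (x *_) ys)     ≡⟨ cong (x * y *_) (∏-map-* x ys) ⟩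
    x * y * (∏ ys * x ^ length ys)     ≡⟨ cong (_* (∏ ys * x ^ length ys)) (*-comm x y) ⟩
    y * x * (∏ ys * x ^ length ys)     ≡⟨ interchange R.*-commutativeSemigroup y x (∏ ys) (x ^ length ys) ⟩
    y * ∏ ys * (x * x ^ length ys)     ≡⟨ cong (y * ∏ ys *_) (^-suc x (length ys)) ⟨
    y * ∏ ys * x ^ suc (length ys)     ∎
    where open ≡-Reasoning

  -- Multiplication by `x` permutes `S`, so the product P of all elements satisfies P = P · x^|S|.
  -- Since P lies in `S`, it has an inverse and cancels.
  lagrange : ∀ {S : Subset n} → IsSubgroup S → ∀ {x} → x ∈ S → x ^ ∣ S ∣ ≡ 1#
  lagrange {S} S-subgroup {x} x∈S
    with y , y∈S , xy≡1 ← IsSubgroup.⁻¹-closed S-subgroup x∈S =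
    *-cancelˡ-invertible (∏ ys) (proj₁ ∏-inverse) _ _ (proj₂ (proj₂ ∏-inverse)) (begin
      ∏ ys * x ^ ∣ S ∣           ≡⟨ cong (λ k → ∏ ys * x ^ k) (length-elements S) ⟨
      ∏ ys * x ^ length ys       ≡⟨ ∏-map-* x ys ⟨
      ∏ (List.map (x *_) ys)     ≡⟨ ∏-↭ (map-*-↭ y y∈S xy≡1) ⟩
      ∏ ys                       ≡⟨ *-identityʳ (∏ ys) ⟨
      ∏ ys * 1#                  ∎)
    where
    open ≡-Reasoning
    open IsSubgroup S-subgroup

    ys = elements S

    ∏∈S : ∀ zs → (∀ {z} → z ∈ˡ zs → z ∈ S) → ∏ zs ∈ S
    ∏∈S []       _    = 1∈
    ∏∈S (z ∷ zs) zs⊆S = *-closed (zs⊆S (here refl)) (∏∈S zs (zs⊆S ∘ there))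

    ∏-inverse : ∃[ z ] (z ∈ S × ∏ ys * z ≡ 1#)
    ∏-inverse = ⁻¹-closed (∏∈S ys (∈-elements⁻ S))

    map-*-↭ : ∀ y → y ∈ S → x * y ≡ 1# → List.map (x *_) ys ↭ ys
    -- Neither list repeats an element and both have the same members, so they are permutations of
    -- each other.
    map-*-↭ y y∈S xy≡1 = ∼bag⇒↭ (unique∧set⇒bag
      (Unique.map⁺ (λ {z} {w} → *-cancelˡ-invertible x y z w xy≡1) (elements-unique S))
      (elements-unique S)
      (mk⇔ xys⊆ys ys⊆xys))
      where
      xys⊆ys : ∀ {z} → z ∈ˡ List.map (x *_) ys → z ∈ˡ ys
      xys⊆ys z∈ with w , w∈ , refl ← ∈-map⁻ (x *_) z∈ = ∈-elements⁺ (*-closed x∈S (∈-elements⁻ S w∈))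

      ys⊆xys : ∀ {z} → z ∈ˡ ys → z ∈ˡ List.map (x *_) ys
      ys⊆xys {z} z∈ = subst (_∈ˡ List.map (x *_) ys)
        (*-leftInverse x y z xy≡1)
        (∈-map⁺ (x *_) (∈-elements⁺ (*-closed y∈S (∈-elements⁻ S z∈))))

-- Prime fields

module _ {n : ℕ} .{{_ : NonZero n}} where

  -- Coefficients are listed from degree 0 upwards; the leading 1 is implicit.
  Monic : ℕ → Set
  Monic = Vec (Fin n)

  eval : ∀ {d} → Monic d → Fin n → Fin n
  eval []      x = 1#
  eval (c ∷ f) x = c + x * eval f x

  -- Horner's scheme for division by X - a: the coefficients of the quotient are the values at `a`
  -- of the tails of the coefficient list.
  quotient : ∀ {d} → Monic (suc d) → Fin n → Monic d
  quotient (c ∷ [])        a = []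
  quotient (c ∷ f@(_ ∷ _)) a = eval f a ∷ quotient f a

  private
    module R = CommutativeRing (+-*-commutativeRing {n})

  -- The factorisation f(x) − f(a) = (x − a) q(x), without subtraction.
  eval-quotient : ∀ {d} (f : Monic (suc d)) a x →
                  a * eval (quotient f a) x + eval f x ≡ x * eval (quotient f a) x + eval f a
  eval-quotient (c ∷ [])        a x = x∙yz≈z∙yx R.+-commutativeSemigroup (a * 1#) c (x * 1#)
  eval-quotient (c ∷ f@(_ ∷ _)) a x = begin
    a * (fa + x * qx) + (c + x * fx)       ≡⟨ cong (_+ (c + x * fx)) expand ⟩
    a * fa + x * (a * qx) + (c + x * fx)   ≡⟨ interchange +-csg (a * fa) (x * (a * qx)) c (x * fx) ⟩
    a * fa + c + (x * (a * qx) + x * fx)   ≡⟨ cong (a * fa + c +_) (*-distribˡ-+ x (a * qx) fx) ⟨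
    a * fa + c + x * (a * qx + fx)         ≡⟨ cong (λ y → a * fa + c + x * y) (eval-quotient f a x) ⟩
    a * fa + c + x * (x * qx + fa)         ≡⟨ cong (λ y → a * fa + c + x * y) (+-comm (x * qx) fa) ⟩
    a * fa + c + x * (fa + x * qx)         ≡⟨ +-comm (a * fa + c) (x * (fa + x * qx)) ⟩
    x * (fa + x * qx) + (a * fa + c)       ≡⟨ cong (x * (fa + x * qx) +_) (+-comm (a * fa) c) ⟩
    x * (fa + x * qx) + (c + a * fa)       ∎
    where
    open ≡-Reasoning
    +-csg = R.+-commutativeSemigroup
    fa = eval f a
    fx = eval f x
    qx = eval (quotient f a) x
    expand : a * (fa + x * qx) ≡ a * fa + x * (a * qx)
    expand = trans (*-distribˡ-+ a fa (x * qx))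
      (cong (a * fa +_) (x∙yz≈y∙xz R.*-commutativeSemigroup a x qx))

  shift : ∀ k {d} → Monic d → Monic (k ℕ.+ d)
  shift k f = replicate k 0# ++ f

  eval-shift : ∀ k {d} (f : Monic d) x → eval (shift k f) x ≡ x ^ k * eval f x
  eval-shift zero    f x = sym (*-identityˡ (eval f x))
  eval-shift (suc k) f x = begin
    0# + x * eval (shift k f) x   ≡⟨ +-identityˡ (x * eval (shift k f) x) ⟩
    x * eval (shift k f) x        ≡⟨ cong (x *_) (eval-shift k f x) ⟩
    x * (x ^ k * eval f x)        ≡⟨ *-assoc x (x ^ k) (eval f x) ⟨
    x * x ^ k * eval f x          ≡⟨ cong (_* eval f x) (^-suc x k) ⟨
    x ^ suc k * eval f x          ∎
    where open ≡-Reasoning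

  eval-∷-shift : ∀ c k {d} (f : Monic d) x → eval (c ∷ shift k f) x ≡ c + x ^ suc k * eval f x
  -- Prepending the summand `0#` turns `x * eval (shift k f) x` into the value of `shift (suc k) f`.
  eval-∷-shift c k f x = cong (c +_) (trans (sym (+-identityˡ _)) (eval-shift (suc k) f x))

  -- The sum 1 + Y + ⋯ + Yᵐ with Y = Xᵏ⁺¹. The constant term takes up one degree, so each round
  -- shifts by `k` only.
  geometric : ∀ k m → Monic (m ℕ.* suc k)
  geometric k zero    = []
  geometric k (suc m) = 1# ∷ shift k (geometric k m)

  -- The identity (Y - 1)(1 + Y + ⋯ + Yᵐ) = Yᵐ⁺¹ - 1 with the negative terms moved across, so that
  -- it stays free of subtraction.
  eval-geometric : ∀ k m x → x ^ suc k * eval (geometric k m) x + 1#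
                             ≡ eval (geometric k m) x + x ^ (suc m ℕ.* suc k)
  eval-geometric k zero x = begin
    x ^ suc k * 1# + 1#   ≡⟨ +-comm (x ^ suc k * 1#) 1# ⟩
    1# + x ^ suc k * 1#   ≡⟨ cong (1# +_) (*-identityʳ (x ^ suc k)) ⟩
    1# + x ^ suc k        ≡⟨ cong (λ j → 1# + x ^ suc j) (ℕ.+-identityʳ k) ⟨
    1# + x ^ suc (k ℕ.+ 0) ∎
    where open ≡-Reasoning
  eval-geometric k (suc m) x = begin
    xᵏ * eval (geometric k (suc m)) x + 1#        ≡⟨ cong (λ y → xᵏ * y + 1#) step ⟩
    xᵏ * (1# + xᵏ * g) + 1#                       ≡⟨ cong (λ y → xᵏ * y + 1#) (+-comm 1# (xᵏ * g)) ⟩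
    xᵏ * (xᵏ * g + 1#) + 1#                       ≡⟨ cong (λ y → xᵏ * y + 1#) (eval-geometric k m x) ⟩
    xᵏ * (g + x ^ (suc m ℕ.* suc k)) + 1#         ≡⟨ +-comm _ 1# ⟩
    1# + xᵏ * (g + x ^ (suc m ℕ.* suc k))         ≡⟨ cong (1# +_) (*-distribˡ-+ xᵏ g (x ^ (suc m ℕ.* suc k))) ⟩
    1# + (xᵏ * g + xᵏ * x ^ (suc m ℕ.* suc k))    ≡⟨ +-assoc 1# (xᵏ * g) (xᵏ * x ^ (suc m ℕ.* suc k)) ⟨
    1# + xᵏ * g + xᵏ * x ^ (suc m ℕ.* suc k)      ≡⟨ cong₂ _+_ (sym step) (sym (^-distribˡ-+-* x (suc k) (suc m ℕ.* suc k))) ⟩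
    eval (geometric k (suc m)) x + x ^ (suc (suc m) ℕ.* suc k) ∎
    where
    open ≡-Reasoning
    xᵏ = x ^ suc k
    g = eval (geometric k m) x
    step : eval (geometric k (suc m)) x ≡ 1# + xᵏ * g
    step = eval-∷-shift 1# k (geometric k m) x

⟦_⟧ : ∀ {n} {P : Pred (Fin n) 0ℓ} → Decidable P → Subset n
⟦ P? ⟧ = tabulate (λ x → does (P? x))

∈⟦⟧⁺ : ∀ {n} {P : Pred (Fin n) 0ℓ} (P? : Decidable P) {x} → P x → x ∈ ⟦ P? ⟧
∈⟦⟧⁺ P? {x} Px = lookup⇒[]= x _ (trans (lookup∘tabulate _ x) (dec-true (P? x) Px))

∈⟦⟧⁻ : ∀ {n} {P : Pred (Fin n) 0ℓ} (P? : Decidable P) {x} → x ∈ ⟦ P? ⟧ → P x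
∈⟦⟧⁻ P? {x} x∈ with P? x | trans (sym (lookup∘tabulate (λ y → does (P? y)) x)) ([]=⇒lookup x∈)
... | yes Px | _ = Px

-- Inverses, numbers of roots and roots of unity modulo a prime

module PrimeField {n : ℕ} .{{_ : NonZero n}} (n-prime : Prime n) where

  1<n : 1 < n
  1<n = ℕ.nonTrivial⇒n>1 n {{prime⇒nonTrivial n-prime}}

  toℕ-0# : toℕ (0# {n}) ≡ 0
  toℕ-0# = trans (toℕ-mod 0) (m<n⇒m%n≡m (ℕ.<-trans ℕ.z<s 1<n))

  1≢0 : 1# ≢ 0# {n}
  1≢0 1≡0 = case trans (sym (trans (toℕ-mod 1) (m<n⇒m%n≡m 1<n))) (trans (cong toℕ 1≡0) toℕ-0#) of λ ()

  ≢0⇒invertible : ∀ (x : Fin n) → x ≢ 0# → ∃[ y ] x * y ≡ 1#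
  ≢0⇒invertible x x≢0 with coprime-Bézout (prime⇒coprime n-prime {{ℕ.≢-nonZero toℕx≢0}} (toℕ<n x))
    where
    toℕx≢0 : toℕ x ≢ 0
    toℕx≢0 eq = x≢0 (toℕ-injective (trans eq (sym toℕ-0#)))
  -- Bézout gives either 1 + b x = a n, where b inverts `x` up to sign, or 1 + a n = b x, where b
  -- itself is the inverse.
  ... | Bézout.+- a b eq = - (b mod n) , (begin
    x * - (b mod n)     ≡⟨ -‿distribʳ-* x (b mod n) ⟨
    - (x * (b mod n))   ≡⟨ +≡0⇒≡- 1# (x * (b mod n)) 1+xb≡0 ⟨
    1#                  ∎)
    where
    open ≡-Reasoning
    1+xb≡0 : 1# + x * (b mod n) ≡ 0#
    1+xb≡0 = begin
      1# + x * (b mod n)              ≡⟨ cong (1# +_) (trans (*-comm x (b mod n)) (mod-*ˡ b x)) ⟩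
      1# + (b ℕ.* toℕ x) mod n        ≡⟨ mod-+ 1 (b ℕ.* toℕ x) ⟩
      (1 ℕ.+ b ℕ.* toℕ x) mod n       ≡⟨ cong (_mod n) eq ⟩
      (a ℕ.* n) mod n                 ≡⟨ mod-cong (trans (m*n%n≡0 a n) (sym (m*n%n≡0 0 n))) ⟩
      0#                              ∎
  ... | Bézout.-+ a b eq = b mod n , (begin
    x * (b mod n)               ≡⟨ trans (*-comm x (b mod n)) (mod-*ˡ b x) ⟩
    (b ℕ.* toℕ x) mod n         ≡⟨ cong (_mod n) eq ⟨
    (1 ℕ.+ a ℕ.* n) mod n       ≡⟨ mod-cong ([m+kn]%n≡m%n 1 a n) ⟩
    1#                          ∎)
    where open ≡-Reasoning

  *-cancelˡ-≢0 : ∀ (x y z : Fin n) → x ≢ 0# → x * y ≡ x * z → y ≡ z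
  *-cancelˡ-≢0 x y z x≢0 with x⁻¹ , xx⁻¹≡1 ← ≢0⇒invertible x x≢0 = *-cancelˡ-invertible x x⁻¹ y z xx⁻¹≡1

  -- Absence of zero divisors, applied to (x - y) z = 0; this form accepts the subtraction-free
  -- identities directly.
  *-cancelʳ-≡0 : ∀ (x y z : Fin n) → x ≢ y → x * z ≡ y * z → z ≡ 0#
  *-cancelʳ-≡0 x y z x≢y xz≡yz with z ≟ 0#
  ... | yes z≡0 = z≡0
  ... | no  z≢0 = contradiction
    (*-cancelˡ-≢0 z x y z≢0 (trans (*-comm z x) (trans xz≡yz (*-comm y z)))) x≢y

  ^≡1⇒≢0 : ∀ k (x : Fin n) → .{{_ : NonZero k}} → x ^ k ≡ 1# → x ≢ 0#
  ^≡1⇒≢0 (suc k) x xᵏ≡1 refl = 1≢0 (trans (sym xᵏ≡1) (trans (^-suc 0# k) (zeroˡ (0# ^ k))))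

  -- One factor of (x - 1)(x + 1) = 0 has to vanish.
  square≡1 : ∀ (x : Fin n) → x * x ≡ 1# → x ≢ 1# → x ≡ - 1#
  square≡1 x xx≡1 x≢1 = +≡0⇒≡- x 1# (*-cancelʳ-≡0 x 1# (x + 1#) x≢1 (begin
    x * (x + 1#)     ≡⟨ *-distribˡ-+ x x 1# ⟩
    x * x + x * 1#   ≡⟨ cong₂ _+_ xx≡1 (*-identityʳ x) ⟩
    1# + x           ≡⟨ +-comm 1# x ⟩
    x + 1#           ≡⟨ *-identityˡ (x + 1#) ⟨
    1# * (x + 1#)    ∎))
    where open ≡-Reasoning

  -- Induction on the list: by the factorisation at a root `a`, every other root is a root of the
  -- quotient, whose degree is one less. In degree 0 the polynomial is the constant 1.
  roots-≤-degree : ∀ {d} (f : Monic d) {xs : List (Fin n)} → Unique xs →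
                   All (λ x → eval f x ≡ 0#) xs → length xs ℕ.≤ d
  roots-≤-degree f       []             []           = ℕ.z≤n
  roots-≤-degree []      (_ ∷ _)        (1≡0 ∷ _)    = contradiction 1≡0 1≢0
  roots-≤-degree f@(_ ∷ _) {a ∷ xs} (a≢xs ∷ unique) (fa≡0 ∷ roots) =
    ℕ.s≤s (roots-≤-degree (quotient f a) unique (All.zipWith quotient-root (a≢xs , roots)))
    where
    quotient-root : ∀ {x} → a ≢ x × eval f x ≡ 0# → eval (quotient f a) x ≡ 0#
    quotient-root {x} (a≢x , fx≡0) = *-cancelʳ-≡0 a x _ a≢x (+-cancelʳ 0# _ _ (begin
      a * eval (quotient f a) x + 0#         ≡⟨ cong (a * eval (quotient f a) x +_) fx≡0 ⟨
      a * eval (quotient f a) x + eval f x   ≡⟨ eval-quotient f a x ⟩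
      x * eval (quotient f a) x + eval f a   ≡⟨ cong (x * eval (quotient f a) x +_) fa≡0 ⟩
      x * eval (quotient f a) x + 0#         ∎))
      where open ≡-Reasoning

  ∣roots∣≤degree : ∀ {d} (f : Monic d) (S : Subset n) → (∀ {x} → x ∈ S → eval f x ≡ 0#) → ∣ S ∣ ℕ.≤ d
  ∣roots∣≤degree f S roots = subst (ℕ._≤ _) (length-elements S)
    (roots-≤-degree f (elements-unique S) (All.tabulate (roots ∘ ∈-elements⁻ S)))

  ∣^≡1∣≤ : ∀ r .{{_ : NonZero r}} (S : Subset n) → (∀ {x} → x ∈ S → x ^ r ≡ 1#) → ∣ S ∣ ℕ.≤ r
  -- The polynomial is Xᵏ⁺¹ - 1. Its degree computes to `suc (k + 0)`, which the `subst` simplifies.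
  ∣^≡1∣≤ (suc k) S S⊆ = subst (∣ S ∣ ℕ.≤_) (cong suc (ℕ.+-identityʳ k))
    (∣roots∣≤degree (- 1# ∷ shift k []) S (λ {x} x∈S → root x (S⊆ x∈S)))
    where
    root : ∀ (x : Fin n) → x ^ suc k ≡ 1# → eval (- 1# ∷ shift k []) x ≡ 0#
    root x xᵏ≡1 = begin
      eval (- 1# ∷ shift k []) x   ≡⟨ eval-∷-shift (- 1#) k [] x ⟩
      - 1# + x ^ suc k * 1#        ≡⟨ cong (- 1# +_) (trans (*-identityʳ (x ^ suc k)) xᵏ≡1) ⟩
      - 1# + 1#                    ≡⟨ trans (+-comm (- 1#) 1#) (-‿inverseʳ 1#) ⟩
      0#                           ∎
      where open ≡-Reasoning

  -- Lagrange's theorem for the group of non-zero elements, realised as the complement of a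
  -- singleton with n - 1 elements.
  fermat : ∀ (x : Fin n) → x ≢ 0# → x ^ (n ∸ 1) ≡ 1#
  fermat x x≢0 = subst (λ k → x ^ k ≡ 1#)
    (trans (∣∁p∣≡n∸∣p∣ ⁅ 0# ⁆) (cong (n ∸_) (∣⁅x⁆∣≡1 (0# {n}))))
    (lagrange nonzero-subgroup (≢0⇒∈ x≢0))
    where
    ≢0⇒∈ : ∀ {x : Fin n} → x ≢ 0# → x ∈ ∁ ⁅ 0# ⁆
    ≢0⇒∈ x≢0 = x∉p⇒x∈∁p (x≢0 ∘ x∈⁅y⁆⇒x≡y 0#)

    ∈⇒≢0 : ∀ {x : Fin n} → x ∈ ∁ ⁅ 0# ⁆ → x ≢ 0#
    ∈⇒≢0 x∈ refl = x∈∁p⇒x∉p x∈ (x∈⁅x⁆ 0#)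

    nonzero-subgroup : IsSubgroup (∁ ⁅ 0# {n} ⁆)
    nonzero-subgroup = record
      { 1∈        = ≢0⇒∈ 1≢0
      ; *-closed  = λ {x} {y} x∈ y∈ → ≢0⇒∈ (λ xy≡0 →
          ∈⇒≢0 y∈ (*-cancelˡ-≢0 x y 0# (∈⇒≢0 x∈) (trans xy≡0 (sym (zeroʳ x)))))
      ; ⁻¹-closed = λ {x} x∈ → case ≢0⇒invertible x (∈⇒≢0 x∈) of λ
          { (y , xy≡1) → y , ≢0⇒∈ (λ { refl → 1≢0 (trans (sym xy≡1) (zeroʳ x)) }) , xy≡1 }
      }

  ^≡1? : ∀ r → Decidable (λ (x : Fin n) → x ^ r ≡ 1#)
  ^≡1? r x = x ^ r ≟ 1#

  roots-of-unity : ℕ → Subset n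
  roots-of-unity r = ⟦ ^≡1? r ⟧

  roots-of-unity-subgroup : ∀ r .{{_ : NonZero r}} → IsSubgroup (roots-of-unity r)
  roots-of-unity-subgroup r@(suc k) = record
    { 1∈        = ∈⟦⟧⁺ (^≡1? r) (^-zeroˡ r)
    ; *-closed  = λ {x} {y} x∈ y∈ → ∈⟦⟧⁺ (^≡1? r) (*-^≡1 r x y (∈⟦⟧⁻ (^≡1? r) x∈) (∈⟦⟧⁻ (^≡1? r) y∈))
    ; ⁻¹-closed = λ {x} x∈ → x ^ k , ∈⟦⟧⁺ (^≡1? r) (^-^≡1 x k r (∈⟦⟧⁻ (^≡1? r) x∈))
                                   , ^-inverse r x (∈⟦⟧⁻ (^≡1? r) x∈)
    }

  r∣n∸1⇒nonZero : ∀ {r} → r ∣ n ∸ 1 → NonZero r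
  r∣n∸1⇒nonZero {zero}  0∣n∸1 = contradiction (0∣⇒≡0 0∣n∸1) (ℕ.m>n⇒m∸n≢0 1<n)
  r∣n∸1⇒nonZero {suc _} _     = _

  -- The elements outside the r-th roots of unity are roots of X (1 + Xʳ + ⋯ + Xᵏʳ),
  -- where n - 1 = (k + 1) r.
  ∣roots-of-unity∣ : ∀ r → r ∣ n ∸ 1 → ∣ roots-of-unity r ∣ ≡ r
  ∣roots-of-unity∣ zero      0∣n∸1 = contradiction (0∣⇒≡0 0∣n∸1) (ℕ.m>n⇒m∸n≢0 1<n)
  ∣roots-of-unity∣ r@(suc _) (divides zero n∸1≡0) = contradiction n∸1≡0 (ℕ.m>n⇒m∸n≢0 1<n)
  ∣roots-of-unity∣ r@(suc j) (divides (suc k) n∸1≡) =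
    -- The upper bound r is the root count of Xʳ - 1. The complement has at most 1 + k r elements,
    -- and n = r + (1 + k r), so at least r elements remain for `S`.
    ℕ.≤-antisym (∣^≡1∣≤ r S (∈⟦⟧⁻ (^≡1? r))) (ℕ.+-cancelʳ-≤ (suc (k ℕ.* r)) r ∣ S ∣ (begin
      r ℕ.+ suc (k ℕ.* r)       ≡⟨ ℕ.+-suc r (k ℕ.* r) ⟩
      suc (suc k ℕ.* r)         ≡⟨ cong suc n∸1≡ ⟨
      suc (n ∸ 1)               ≡⟨ ℕ.m+[n∸m]≡n (ℕ.<⇒≤ 1<n) ⟩
      n                         ≤⟨ ℕ.m≤n+m∸n n ∣ S ∣ ⟩
      ∣ S ∣ ℕ.+ (n ∸ ∣ S ∣)     ≡⟨ cong (∣ S ∣ ℕ.+_) (∣∁p∣≡n∸∣p∣ S) ⟨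
      ∣ S ∣ ℕ.+ ∣ ∁ S ∣         ≤⟨ ℕ.+-monoʳ-≤ ∣ S ∣ ∣∁S∣≤ ⟩
      ∣ S ∣ ℕ.+ suc (k ℕ.* r)   ∎))
    where
    open ℕ.≤-Reasoning
    S = roots-of-unity r

    root : ∀ (x : Fin n) → x ^ r ≢ 1# → eval (0# ∷ geometric j k) x ≡ 0#
    root x xʳ≢1 with x ≟ 0#
    ... | yes refl = trans (+-identityˡ _) (zeroˡ (eval (geometric j k) 0#))
    ... | no  x≢0  = trans (+-identityˡ _) (trans (cong (x *_) g≡0) (zeroʳ x))
      where
      g = eval (geometric j k) x
      g≡0 : g ≡ 0#
      -- Fermat's theorem reduces the geometric identity to xʳ g + 1 = g + 1, while xʳ ≠ 1.
      g≡0 = *-cancelʳ-≡0 (x ^ r) 1# g xʳ≢1 (+-cancelʳ 1# _ _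
        (trans (eval-geometric j k x) (cong₂ _+_ (sym (*-identityˡ g))
          (trans (cong (x ^_) (sym n∸1≡)) (fermat x x≢0)))))

    ∣∁S∣≤ : ∣ ∁ S ∣ ℕ.≤ suc (k ℕ.* r)
    ∣∁S∣≤ = ∣roots∣≤degree (0# ∷ geometric j k) (∁ S)
      (λ {x} x∈ → root x (x∈∁p⇒x∉p x∈ ∘ ∈⟦⟧⁺ (^≡1? r)))

  -- Together with its converse below, this replaces the existential over subgroups by an equation,
  -- the form in which later arguments handle `H`.
  H⇒^≡1 : ∀ r (x : Fin n) → H n r x → x ^ r ≡ 1#
  H⇒^≡1 r x (S , S-subgroup , refl , x∈S) = lagrange S-subgroup x∈S

  ^≡1⇒H : ∀ r (x : Fin n) → r ∣ n ∸ 1 → x ^ r ≡ 1# → H n r x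
  ^≡1⇒H r x r∣n∸1 xʳ≡1 =
    roots-of-unity r , roots-of-unity-subgroup r {{r∣n∸1⇒nonZero r∣n∸1}} ,
    ∣roots-of-unity∣ r r∣n∸1 , ∈⟦⟧⁺ (^≡1? r) xʳ≡1

-- A finite set and its relations under an injective self-map

fold-injective : ∀ {A : Set} {f : A → A} → (∀ {x y} → f x ≡ f y → x ≡ y) →
                 ∀ k {x y} → fold x f k ≡ fold y f k → x ≡ y
fold-injective f-inj zero    eq = eq
fold-injective f-inj (suc k) eq = fold-injective f-inj k (f-inj eq)

-- Among the N + 1 points x, f x, ..., fᴺ x two coincide, and injectivity cancels the common initial
-- iterations. The result displays an outermost `f`, so that a property of the values of `f` can be
-- read off at `x`.
injective⇒recurrent : ∀ {A : Set} {N : ℕ} (encode : A → Fin N) →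
                      (∀ {x y} → encode x ≡ encode y → x ≡ y) →
                      (f : A → A) → (∀ {x y} → f x ≡ f y → x ≡ y) →
                      ∀ x → ∃[ k ] f (fold x f k) ≡ x
injective⇒recurrent {N = N} encode encode-inj f f-inj x
  with i , j , i<j , eq ← pigeonhole (ℕ.n<1+n N) (λ i → encode (fold x f (toℕ i)))
  -- The witness is k = j - i - 1, because i < j unfolds to `suc i ≤ j`.
  with k , eq′ ← ℕ.m≤n⇒∃[o]m+o≡n i<j
  = k , sym (fold-injective f-inj (toℕ i) (begin
    fold x f (toℕ i)                      ≡⟨ encode-inj eq ⟩
    fold x f (toℕ j)                      ≡⟨ cong (fold x f) (trans (ℕ.+-suc (toℕ i) k) eq′) ⟨
    fold x f (toℕ i ℕ.+ suc k)            ≡⟨ fold-+ x f (toℕ i) ⟩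
    fold (f (fold x f k)) f (toℕ i)       ∎))
  where open ≡-Reasoning

-- Pulling Δ back along the isomorphism maps arcs of Δ to arcs of Γ ⊆ Δ; on a finite vertex set
-- some iterate of this map fixes any given pair.
⊆∧≅⇒⊇ : ∀ {V : Set} {N : ℕ} (encode : V × V → Fin N) → (∀ {x y} → encode x ≡ encode y → x ≡ y) →
        {Γ Δ : Digraph V} → Γ ⇒ Δ → Γ ≅ Δ → Δ ⇒ Γ
⊆∧≅⇒⊇ {V} encode encode-inj {Γ} {Δ} Γ⇒Δ Γ≅Δ {x} {y} xΔy =
  let k , returns = injective⇒recurrent encode encode-inj pull pull-injective (x , y)
  in subst (Arc Γ) returns (pull-arc (fold (x , y) pull k) (pulls-arc k))
  where
  open _≅_ Γ≅Δ
  open Inverse bij using (strictlyInverseˡ)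

  Arc : Digraph V → V × V → Set
  Arc Θ (x , y) = Θ x y

  pull : V × V → V × V
  pull (x , y) = from x , from y

  from-injective : ∀ {x y} → from x ≡ from y → x ≡ y
  from-injective eq = trans (sym (strictlyInverseˡ _)) (trans (cong to eq) (strictlyInverseˡ _))

  pull-injective : ∀ {v w} → pull v ≡ pull w → v ≡ w
  pull-injective eq = cong₂ _,_ (from-injective (cong proj₁ eq)) (from-injective (cong proj₂ eq))

  pull-arc : ∀ v → Arc Δ v → Arc Γ (pull v)
  pull-arc (x , y) xΔy = Equivalence.from (adjacent (from x) (from y))
    (subst₂ Δ (sym (strictlyInverseˡ x)) (sym (strictlyInverseˡ y)) xΔy)

  pulls-arc : ∀ k → Arc Δ (fold (x , y) pull k)
  pulls-arc zero    = xΔy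
  -- A pulled-back arc lies in Γ; the inclusion returns it to Δ, where it can be pulled back again.
  pulls-arc (suc k) = Γ⇒Δ (pull-arc _ (pulls-arc k))

encode-pairs : ∀ {m n} → (Fin m × Fin n) × (Fin m × Fin n) → Fin ((m ℕ.* n) ℕ.* (m ℕ.* n))
encode-pairs ((i , x) , (j , y)) = combine (combine i x) (combine j y)

encode-pairs-injective : ∀ {m n} {v w : (Fin m × Fin n) × (Fin m × Fin n)} →
                         encode-pairs v ≡ encode-pairs w → v ≡ w
encode-pairs-injective {v = (i , x) , (j , y)} {(i′ , x′) , (j′ , y′)} eq
  with eqˡ , eqʳ ← combine-injective (combine i x) (combine j y) (combine i′ x′) (combine j′ y′) eq
  with refl , refl ← combine-injective i x i′ x′ eqˡ | refl , refl ← combine-injective j y j′ y′ eqʳ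
  = refl

-- Circulants and their products

⊗-cong : ∀ {V V′ W W′ : Set} {Γ : Digraph V} {Γ′ : Digraph V′} {Ψ : Digraph W} {Ψ′ : Digraph W′} →
         Γ ≅ Γ′ → Ψ ≅ Ψ′ → Γ ⊗ Ψ ≅ Γ′ ⊗ Ψ′
⊗-cong φ ψ = record
  { bij      = _≅_.bij φ ×-↔ _≅_.bij ψ
  ; adjacent = λ (u , x) (v , y) → _≅_.adjacent φ u v ×-⇔ _≅_.adjacent ψ x y
  }

module Circulant {n : ℕ} .{{_ : NonZero n}} (n-prime : Prime n) (r : ℕ) (r∣n∸1 : r ∣ n ∸ 1) where

  open PrimeField n-prime

  private instance
    r≢0 : NonZero r
    r≢0 = r∣n∸1⇒nonZero r∣n∸1

  H-*-⇔ : ∀ (c x : Fin n) → c ^ r ≡ 1# → H n r x ⇔ H n r (c * x)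
  H-*-⇔ c x cʳ≡1 = mk⇔
    (λ x∈H → ^≡1⇒H r (c * x) r∣n∸1 (trans cx^r (H⇒^≡1 r x x∈H)))
    (λ cx∈H → ^≡1⇒H r x r∣n∸1 (trans (sym cx^r) (H⇒^≡1 r (c * x) cx∈H)))
    where
    cx^r : (c * x) ^ r ≡ x ^ r
    cx^r = trans (^-distribʳ-* r c x) (trans (cong (_* x ^ r) cʳ≡1) (*-identityˡ (x ^ r)))

  G-irreflexive : Irreflexive _≡_ (G n r)
  G-irreflexive {x} refl x~x = ^≡1⇒≢0 r (x - x) (H⇒^≡1 r (x - x) x~x) (-‿inverseʳ x)

  G-symmetric : (- 1# {n}) ^ r ≡ 1# → Symmetric (G n r)
  G-symmetric -1ʳ≡1 {x} {y} x~y = subst (H n r)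
    (trans (-1*x≈-x (y - x)) (-‿anti-homo‿- y x))
    (Equivalence.to (H-*-⇔ (- 1#) (y - x) -1ʳ≡1) x~y)

  -- The offset cancels in differences, which are therefore multiplied by `c`, an element of H(n,
  -- r).
  affine : (c b : Fin n) → c ^ r ≡ 1# → Aut (G n r)
  affine c b cʳ≡1 = record
    { bij      = mk↔ₛ′ f g fg gf
    ; adjacent = λ x y → subst (λ z → H n r (y - x) ⇔ H n r z) (sym (f-difference x y))
                           (H-*-⇔ c (y - x) cʳ≡1)
    }
    where
    open ≡-Reasoning

    c⁻¹ = c ^ (r ∸ 1)
    f g : Fin n → Fin n
    f z = c * z + b
    g z = c⁻¹ * (z - b)

    cc⁻¹≡1 : c * c⁻¹ ≡ 1#
    cc⁻¹≡1 = ^-inverse r c cʳ≡1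

    fg : ∀ z → f (g z) ≡ z
    fg z = trans (cong (_+ b) (*-leftInverse c c⁻¹ (z - b) cc⁻¹≡1)) ([x-y]+y≡x b z)

    gf : ∀ z → g (f z) ≡ z
    gf z = trans (cong (c⁻¹ *_) ([x+y]-y≡x b (c * z)))
                 (*-leftInverse c⁻¹ c z (trans (*-comm c⁻¹ c) cc⁻¹≡1))

    f-difference : ∀ x y → f y - f x ≡ c * (y - x)
    f-difference x y = begin
      (c * y + b) - (c * x + b)         ≡⟨ cong (c * y + b +_) (-‿anti-homo-+ (c * x) b) ⟩
      (c * y + b) + (- b - c * x)       ≡⟨ +-assoc (c * y + b) (- b) (- (c * x)) ⟨
      ((c * y + b) - b) - c * x         ≡⟨ cong (_- (c * x)) ([x+y]-y≡x b (c * y)) ⟩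
      c * y - c * x                     ≡⟨ cong (c * y +_) (-‿distribʳ-* c x) ⟩
      c * y + c * - x                   ≡⟨ *-distribˡ-+ c y (- x) ⟨
      c * (y - x)                       ∎

  translate : ∀ (x y : Fin n) → ∃[ φ ] _≅_.to {Γ = G n r} {Δ = G n r} φ x ≡ y
  translate x y = affine 1# (y - x) (^-zeroˡ r) , (begin
    1# * x + (y - x)   ≡⟨ cong (_+ (y - x)) (*-identityˡ x) ⟩
    x + (y - x)        ≡⟨ +-comm x (y - x) ⟩
    (y - x) + x        ≡⟨ [x-y]+y≡x x y ⟩
    y                  ∎)
    where open ≡-Reasoning

  -- The slope d′/d is a quotient of two elements of H(n, r), hence lies in it; the offset is then
  -- fixed by sending `x` to `x′`.
  transport-arc : ∀ (x y x′ y′ : Fin n) → G n r x y → G n r x′ y′ →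
                  ∃[ φ ] (_≅_.to {Γ = G n r} {Δ = G n r} φ x ≡ x′ × _≅_.to φ y ≡ y′)
  transport-arc x y x′ y′ x~y x′~y′ = affine c b cʳ≡1 , fx≡x′ , fy≡y′
    where
    open ≡-Reasoning
    d = y - x
    d′ = y′ - x′
    d⁻¹ = d ^ (r ∸ 1)
    c = d′ * d⁻¹
    b = x′ - c * x

    dʳ≡1 : d ^ r ≡ 1#
    dʳ≡1 = H⇒^≡1 r d x~y

    cʳ≡1 : c ^ r ≡ 1#
    cʳ≡1 = *-^≡1 r d′ d⁻¹ (H⇒^≡1 r d′ x′~y′) (^-^≡1 d (r ∸ 1) r dʳ≡1)

    cd≡d′ : c * d ≡ d′
    cd≡d′ = begin
      d′ * d⁻¹ * d     ≡⟨ *-assoc d′ d⁻¹ d ⟩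
      d′ * (d⁻¹ * d)   ≡⟨ cong (d′ *_) (*-comm d⁻¹ d) ⟩
      d′ * (d * d⁻¹)   ≡⟨ cong (d′ *_) (^-inverse r d dʳ≡1) ⟩
      d′ * 1#          ≡⟨ *-identityʳ d′ ⟩
      d′               ∎

    fx≡x′ : c * x + b ≡ x′
    fx≡x′ = trans (+-comm (c * x) b) ([x-y]+y≡x (c * x) x′)

    fy≡y′ : c * y + b ≡ y′
    fy≡y′ = begin
      c * y + b               ≡⟨ cong (λ z → c * z + b) ([x-y]+y≡x x y) ⟨
      c * (d + x) + b         ≡⟨ cong (_+ b) (*-distribˡ-+ c d x) ⟩
      c * d + c * x + b       ≡⟨ +-assoc (c * d) (c * x) b ⟩
      c * d + (c * x + b)     ≡⟨ cong₂ _+_ cd≡d′ fx≡x′ ⟩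
      d′ + x′                 ≡⟨ [x-y]+y≡x x′ y′ ⟩
      y′                      ∎

module _ {p q : ℕ} .{{_ : NonZero p}} .{{_ : NonZero q}} (p-prime : Prime p) (q-prime : Prime q)
         {s u : ℕ} (s∣p∸1 : s ∣ p ∸ 1) (u∣q∸1 : u ∣ q ∸ 1)
         (-1ˢ≡1 : (- 1# {p}) ^ s ≡ 1#) (-1ᵘ≡1 : (- 1# {q}) ^ u ≡ 1#) where

  private
    module P = Circulant p-prime s s∣p∸1
    module Q = Circulant q-prime u u∣q∸1

  -- Automorphisms of the factors act coordinatewise, and an arc of the product is a pair of arcs,
  -- each of which can be moved separately.
  G⊗G-isSymmetric : IsSymmetricGraph (G p s ⊗ G q u)
  G⊗G-isSymmetric = record
    { isGraph = (λ {(i , x)} {(j , y)} (i~j , x~y) →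
                   P.G-symmetric -1ˢ≡1 {i} {j} i~j , Q.G-symmetric -1ᵘ≡1 {x} {y} x~y)
              , (λ { {i , _} refl (i~i , _) → P.G-irreflexive {i} refl i~i })
    ; vertexTransitive = λ (i , x) (j , y) →
        let φ , φi≡j = P.translate i j
            ψ , ψx≡y = Q.translate x y
        in ⊗-cong φ ψ , cong₂ _,_ φi≡j ψx≡y
    ; arcTransitive = λ (i , x) (j , y) (i′ , x′) (j′ , y′) (i~j , x~y) (i′~j′ , x′~y′) →
        let φ , φi , φj = P.transport-arc i j i′ j′ i~j i′~j′
            ψ , ψx , ψy = Q.transport-arc x y x′ y′ x~y x′~y′
        in ⊗-cong φ ψ , cong₂ _,_ φi ψx , cong₂ _,_ φj ψy
    }

-- Integer powers and orders of units

module _ {n : ℕ} .{{_ : NonZero n}} where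

  -- A natural number congruent to the given integer modulo N (for N > 0): -(k + 1) becomes (N -
  -- 1)(k + 1). It gives the same power of any unit with N-th power 1.
  natExponent : ℕ → ℤ → ℕ
  natExponent N (ℤ.+ k)    = k
  natExponent N -[1+ k ] = (N ∸ 1) ℕ.* suc k

  ^ᶻ≡^ : ∀ (t : Units {n}) N .{{_ : NonZero N}} → val t ^ N ≡ 1# → ∀ l → t ^ᶻ l ≡ val t ^ natExponent N l
  ^ᶻ≡^ t N tᴺ≡1 (ℤ.+ k)    = refl
  ^ᶻ≡^ t N tᴺ≡1 -[1+ k ] = trans (cong (_^ suc k) inv≡) (^-*-assoc (val t) (N ∸ 1) (suc k))
    where
    inv≡ : inv t ≡ val t ^ (N ∸ 1)
    inv≡ = *-cancelˡ-invertible (val t) (inv t) _ _ (val*inv t)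
      (trans (val*inv t) (sym (^-inverse N (val t) tᴺ≡1)))

  -- The remainder of `m` modulo `k` is also an exponent giving 1, so minimality of `k` forces it to
  -- be 0.
  order-∣ : ∀ (t : Units {n}) {k} m → IsOrder t k → val t ^ m ≡ 1# → k ∣ m
  order-∣ t {k} m (0<k , tᵏ≡1 , minimal) tᵐ≡1 = m%n≡0⇒n∣m m k m%k≡0
    where
    instance
      k≢0 : NonZero k
      k≢0 = ℕ.>-nonZero 0<k

    t^[m%k]≡1 : val t ^ (m % k) ≡ 1#
    t^[m%k]≡1 = begin
      val t ^ (m % k)                               ≡⟨ *-identityʳ (val t ^ (m % k)) ⟨
      val t ^ (m % k) * 1#                          ≡⟨ cong (val t ^ (m % k) *_) (∣⇒^≡1 (val t) tᵏ≡1 (divides (m / k) refl)) ⟨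
      val t ^ (m % k) * val t ^ (m / k ℕ.* k)       ≡⟨ ^-distribˡ-+-* (val t) (m % k) (m / k ℕ.* k) ⟨
      val t ^ (m % k ℕ.+ m / k ℕ.* k)               ≡⟨ cong (val t ^_) (m≡m%n+[m/n]*n m k) ⟨
      val t ^ m                                     ≡⟨ tᵐ≡1 ⟩
      1#                                            ∎
      where open ≡-Reasoning

    m%k≡0 : m % k ≡ 0
    m%k≡0 with m % k ℕ.≟ 0
    ... | yes m%k≡0 = m%k≡0
    ... | no  m%k≢0 = contradiction (minimal (m % k) (ℕ.n≢0⇒n>0 m%k≢0) t^[m%k]≡1) (ℕ.<⇒≱ (m%n<n m k))

-- Comparison of G(pq; r, s, u) with the product of circulants

module PrimeProduct
  {p q : ℕ} .{{_ : NonZero p}} .{{_ : NonZero q}} (p-prime : Prime p) (q-prime : Prime q)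
  {s r : ℕ} (2∣s : 2 ∣ s) (s∣p∸1 : s ∣ p ∸ 1) (r∣q∸1 : r ∣ q ∸ 1)
  (a : Units {p}) (H≐⟨a⟩ : H p s ≐ ⟨ a ⟩)
  (t : Units {q}) (tʰ∈-H : neg (H q r) (val t ^ (s / 2)))
  {o : ℕ} (t-order : IsOrder t o)
  where

  private
    module 𝔽ₚ = PrimeField p-prime
    module 𝔽q = PrimeField q-prime

    u = lcm r o
    h = s / 2
    -- The element of H(q, r) with t^(s/2) = -g₀.
    g₀ = proj₁ tʰ∈-H

    instance
      s≢0 : NonZero s
      s≢0 = 𝔽ₚ.r∣n∸1⇒nonZero s∣p∸1

      r≢0 : NonZero r
      r≢0 = 𝔽q.r∣n∸1⇒nonZero r∣q∸1

      o≢0 : NonZero o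
      o≢0 = ℕ.>-nonZero (proj₁ t-order)

      s*o≢0 : NonZero (s ℕ.* o)
      s*o≢0 = ℕ.m*n≢0 s o

    aˢ≡1 : val a ^ s ≡ 1#
    aˢ≡1 = 𝔽ₚ.H⇒^≡1 s (val a) (proj₂ H≐⟨a⟩ (ℤ.+ 1 , sym (^-identityʳ (val a))))

    tᵒ≡1 : val t ^ o ≡ 1#
    tᵒ≡1 = proj₁ (proj₂ t-order)

    tᵘ≡1 : val t ^ u ≡ 1#
    tᵘ≡1 = ∣⇒^≡1 (val t) tᵒ≡1 (n∣lcm[m,n] r o)

    g₀ʳ≡1 : g₀ ^ r ≡ 1#
    g₀ʳ≡1 = 𝔽q.H⇒^≡1 r g₀ (proj₁ (proj₂ tʰ∈-H))

    tʰ≡-g₀ : val t ^ h ≡ - g₀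
    tʰ≡-g₀ = proj₂ (proj₂ tʰ∈-H)

    -- A single natural exponent has to represent l for both a and t.
    exponent : ℤ → ℕ
    exponent = natExponent (s ℕ.* o)

    a^ᶻ : ∀ l → a ^ᶻ l ≡ val a ^ exponent l
    a^ᶻ = ^ᶻ≡^ a (s ℕ.* o) (∣⇒^≡1 (val a) aˢ≡1 (m∣m*n {s} o))

    t^ᶻ : ∀ l → t ^ᶻ l ≡ val t ^ exponent l
    t^ᶻ = ^ᶻ≡^ t (s ℕ.* o) (∣⇒^≡1 (val t) tᵒ≡1 (divides s refl))

    -- If aᵐ = 1, then all s elements of H(p, s), being powers of `a`, are roots of Xᵐ - 1; hence s
    -- ≤ m.
    a-order : IsOrder a s
    a-order = ℕ.>-nonZero⁻¹ s , aˢ≡1 , λ m 0<m aᵐ≡1 →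
      subst (ℕ._≤ m) (𝔽ₚ.∣roots-of-unity∣ s s∣p∸1)
        (𝔽ₚ.∣^≡1∣≤ m {{ℕ.>-nonZero 0<m}} (𝔽ₚ.roots-of-unity s) (λ {x} x∈ → xᵐ≡1 m aᵐ≡1 x x∈))
      where
      xᵐ≡1 : ∀ m → val a ^ m ≡ 1# → ∀ x → x ∈ 𝔽ₚ.roots-of-unity s → x ^ m ≡ 1#
      xᵐ≡1 m aᵐ≡1 x x∈ =
        let l , x≡aˡ = proj₁ H≐⟨a⟩ (𝔽ₚ.^≡1⇒H s x s∣p∸1 (∈⟦⟧⁻ (𝔽ₚ.^≡1? s) x∈))
        in trans (cong (_^ m) (trans x≡aˡ (a^ᶻ l))) (^-^≡1 (val a) (exponent l) m aᵐ≡1)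

    h*2≡s : h ℕ.* 2 ≡ s
    h*2≡s = m/n*n≡m 2∣s

    -- This power is a square root of 1, and it differs from 1 because 0 < s/2 < s and `a` has order
    -- s.
    aʰ≡-1 : val a ^ h ≡ - 1#
    aʰ≡-1 = 𝔽ₚ.square≡1 (val a ^ h) aʰaʰ≡1 aʰ≢1
      where
      aʰaʰ≡1 : val a ^ h * val a ^ h ≡ 1#
      aʰaʰ≡1 = begin
        val a ^ h * val a ^ h   ≡⟨ ^-distribˡ-+-* (val a) h h ⟨
        val a ^ (h ℕ.+ h)       ≡⟨ cong (λ k → val a ^ (h ℕ.+ k)) (ℕ.+-identityʳ h) ⟨
        val a ^ (2 ℕ.* h)       ≡⟨ cong (val a ^_) (trans (ℕ.*-comm 2 h) h*2≡s) ⟩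
        val a ^ s               ≡⟨ aˢ≡1 ⟩
        1#                      ∎
        where open ≡-Reasoning

      instance
        h≢0 : NonZero h
        h≢0 = ℕ.≢-nonZero (λ h≡0 → ℕ.≢-nonZero⁻¹ s (trans (sym h*2≡s) (cong (ℕ._* 2) h≡0)))

      aʰ≢1 : val a ^ h ≢ 1#
      aʰ≢1 aʰ≡1 = ℕ.<⇒≱ (subst (h <_) h*2≡s (ℕ.m<m*n h 2 (ℕ.s≤s (ℕ.s≤s ℕ.z≤n))))
        (∣⇒≤ (order-∣ a h a-order aʰ≡1))

    -1ˢ≡1 : (- 1# {p}) ^ s ≡ 1#
    -1ˢ≡1 = trans (cong (_^ s) (sym aʰ≡-1)) (^-^≡1 (val a) h s aˢ≡1)

    -- Both g₀ and -g₀ = tʰ have u-th power 1, the first since r ∣ u and the second since o ∣ u; so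
    -- does their quotient -1.
    -1ᵘ≡1 : (- 1# {q}) ^ u ≡ 1#
    -1ᵘ≡1 = begin
      (- 1#) ^ u            ≡⟨ *-identityʳ ((- 1#) ^ u) ⟨
      (- 1#) ^ u * 1#       ≡⟨ cong ((- 1#) ^ u *_) (∣⇒^≡1 g₀ g₀ʳ≡1 (m∣lcm[m,n] r o)) ⟨
      (- 1#) ^ u * g₀ ^ u   ≡⟨ ^-distribʳ-* u (- 1#) g₀ ⟨
      (- 1# * g₀) ^ u       ≡⟨ cong (_^ u) (trans (-1*x≈-x g₀) (sym tʰ≡-g₀)) ⟩
      (val t ^ h) ^ u       ≡⟨ ^-^≡1 (val t) h u tᵘ≡1 ⟩
      1#                    ∎
      where open ≡-Reasoning

    -- The order of `t` divides q - 1 by Fermat's theorem, and `r` does by hypothesis.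
    u∣q∸1 : u ∣ q ∸ 1
    u∣q∸1 = lcm-least r∣q∸1
      (order-∣ t (q ∸ 1) t-order (𝔽q.fermat (val t) (𝔽q.^≡1⇒≢0 o (val t) tᵒ≡1)))

    t^exponent^u≡1 : ∀ l → (val t ^ exponent l) ^ u ≡ 1#
    t^exponent^u≡1 l = ^-^≡1 (val t) (exponent l) u tᵘ≡1

  product-isSymmetric : IsSymmetricGraph (G p s ⊗ G q u)
  product-isSymmetric = G⊗G-isSymmetric p-prime q-prime s∣p∸1 u∣q∸1 -1ˢ≡1 -1ᵘ≡1

  -- As u is a multiple of both r and the order of `t`, each coset tˡ H(q, r) lies in H(q, u).
  Gpq⇒product : Gpq p q r a t ⇒ G p s ⊗ G q u
  Gpq⇒product {i , x} {j , y} (l , j-i≡aˡ , g , g∈H , y-x≡tˡg) =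
    proj₂ H≐⟨a⟩ (l , j-i≡aˡ) ,
    𝔽q.^≡1⇒H u (y - x) u∣q∸1 (begin
      (y - x) ^ u                        ≡⟨ cong (_^ u) (trans y-x≡tˡg (cong (_* g) (t^ᶻ l))) ⟩
      (val t ^ exponent l * g) ^ u       ≡⟨ *-^≡1 u (val t ^ exponent l) g (t^exponent^u≡1 l)
                                              (∣⇒^≡1 g (𝔽q.H⇒^≡1 r g g∈H) (m∣lcm[m,n] r o)) ⟩
      1#                                 ∎)
    where open ≡-Reasoning

  -- Reversing an arc adds s/2 to the exponent l, since -1 = a^(s/2) and -1 ∈ t^(s/2) H(q, r).
  Gpq-symmetric : Symmetric (Gpq p q r a t)
  Gpq-symmetric {i , x} {j , y} (l , j-i≡aˡ , g , g∈H , y-x≡tˡg) =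
    -- From tʰ = -g₀ follows -1 = tʰ g₀⁻¹, so -(tᵏ g) = tʰ⁺ᵏ (g₀⁻¹ g), which gives the new coset
    -- element.
    ℤ.+ (h ℕ.+ k) , i-j≡ , g₀⁻¹ * g ,
    𝔽q.^≡1⇒H r (g₀⁻¹ * g) r∣q∸1
      (*-^≡1 r g₀⁻¹ g (^-^≡1 g₀ (r ∸ 1) r g₀ʳ≡1) (𝔽q.H⇒^≡1 r g g∈H)) ,
    x-y≡
    where
    open ≡-Reasoning
    k = exponent l
    g₀⁻¹ = g₀ ^ (r ∸ 1)

    i-j≡ : i - j ≡ val a ^ (h ℕ.+ k)
    i-j≡ = begin
      i - j                   ≡⟨ -‿anti-homo‿- j i ⟨
      - (j - i)               ≡⟨ cong (λ z → - z) (trans j-i≡aˡ (a^ᶻ l)) ⟩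
      - (val a ^ k)           ≡⟨ -1*x≈-x (val a ^ k) ⟨
      - 1# * val a ^ k        ≡⟨ cong (_* val a ^ k) aʰ≡-1 ⟨
      val a ^ h * val a ^ k   ≡⟨ ^-distribˡ-+-* (val a) h k ⟨
      val a ^ (h ℕ.+ k)       ∎

    tʰg₀⁻¹≡-1 : val t ^ h * g₀⁻¹ ≡ - 1#
    tʰg₀⁻¹≡-1 = begin
      val t ^ h * g₀⁻¹   ≡⟨ cong (_* g₀⁻¹) tʰ≡-g₀ ⟩
      - g₀ * g₀⁻¹        ≡⟨ -‿distribˡ-* g₀ g₀⁻¹ ⟨
      - (g₀ * g₀⁻¹)      ≡⟨ cong (λ z → - z) (^-inverse r g₀ g₀ʳ≡1) ⟩
      - 1#               ∎

    x-y≡ : x - y ≡ val t ^ (h ℕ.+ k) * (g₀⁻¹ * g)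
    x-y≡ = begin
      x - y                                   ≡⟨ -‿anti-homo‿- y x ⟨
      - (y - x)                               ≡⟨ cong (λ z → - z) (trans y-x≡tˡg (cong (_* g) (t^ᶻ l))) ⟩
      - (val t ^ k * g)                       ≡⟨ -1*x≈-x (val t ^ k * g) ⟨
      - 1# * (val t ^ k * g)                  ≡⟨ cong (_* (val t ^ k * g)) tʰg₀⁻¹≡-1 ⟨
      (val t ^ h * g₀⁻¹) * (val t ^ k * g)    ≡⟨ interchange (CommutativeRing.*-commutativeSemigroup +-*-commutativeRing)
                                                   (val t ^ h) g₀⁻¹ (val t ^ k) g ⟩
      (val t ^ h * val t ^ k) * (g₀⁻¹ * g)    ≡⟨ cong (_* (g₀⁻¹ * g)) (^-distribˡ-+-* (val t) h k) ⟨
      val t ^ (h ℕ.+ k) * (g₀⁻¹ * g)          ∎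

  Gpq-isSpanningSubgraph : IsSpanningSubgraph (Gpq p q r a t) (G p s ⊗ G q u)
  Gpq-isSpanningSubgraph =
    ((λ {v} {w} → Gpq-symmetric {v} {w}) , Gpq-irreflexive) ,
    IsSymmetricGraph.isGraph product-isSymmetric ,
    (λ {v} {w} → Gpq⇒product {v} {w})
    where
    Gpq-irreflexive : Irreflexive _≡_ (Gpq p q r a t)
    Gpq-irreflexive {v} refl vGv =
      proj₂ (IsSymmetricGraph.isGraph product-isSymmetric) {v} refl (Gpq⇒product {v} {v} vGv)

  -- If tʳ = 1, the order of `t` divides r, so u ∣ r and y - x lies in H(q, r). So does tˡ, whence
  -- any l with j - i = aˡ serves.
  product⇒Gpq : H q r (val t) → G p s ⊗ G q u ⇒ Gpq p q r a t
  product⇒Gpq t∈H {i , x} {j , y} (j-i∈H , y-x∈H) =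
    l , j-i≡aˡ , tˡ⁻¹ * (y - x) ,
    𝔽q.^≡1⇒H r (tˡ⁻¹ * (y - x)) r∣q∸1
      (*-^≡1 r tˡ⁻¹ (y - x) (^-^≡1 tˡ (r ∸ 1) r tˡʳ≡1) [y-x]ʳ≡1) ,
    sym (trans (cong (_* (tˡ⁻¹ * (y - x))) (t^ᶻ l))
               (*-leftInverse tˡ tˡ⁻¹ (y - x) (^-inverse r tˡ tˡʳ≡1)))
    where
    l = proj₁ (proj₁ H≐⟨a⟩ j-i∈H)
    j-i≡aˡ = proj₂ (proj₁ H≐⟨a⟩ j-i∈H)
    tˡ = val t ^ exponent l
    tˡ⁻¹ = tˡ ^ (r ∸ 1)

    tʳ≡1 : val t ^ r ≡ 1#
    tʳ≡1 = 𝔽q.H⇒^≡1 r (val t) t∈H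

    tˡʳ≡1 : tˡ ^ r ≡ 1#
    tˡʳ≡1 = ^-^≡1 (val t) (exponent l) r tʳ≡1

    u∣r : u ∣ r
    u∣r = lcm-least (divides 1 (sym (ℕ.*-identityˡ r))) (order-∣ t r t-order tʳ≡1)

    [y-x]ʳ≡1 : (y - x) ^ r ≡ 1#
    [y-x]ʳ≡1 = ∣⇒^≡1 (y - x) (𝔽q.H⇒^≡1 u (y - x) y-x∈H) u∣r

  ≅⇒t∈H : Gpq p q r a t ≅ G p s ⊗ G q u → H q r (val t)
  ≅⇒t∈H iso =
    𝔽q.^≡1⇒H r (val t) r∣q∸1 (t∈tˡH⇒tʳ≡1
      (⊆∧≅⇒⊇ encode-pairs encode-pairs-injective (λ {v} {w} → Gpq⇒product {v} {w}) iso {0# , 0#} {1# , val t}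
        ( 𝔽ₚ.^≡1⇒H s (1# - 0#) s∣p∸1 (trans (cong (_^ s) (x-0≡x 1#)) (^-zeroˡ s))
        , 𝔽q.^≡1⇒H u (val t - 0#) u∣q∸1 (trans (cong (_^ u) (x-0≡x (val t))) tᵘ≡1))))
    where
    x-0≡x : ∀ {n} .{{_ : NonZero n}} (x : Fin n) → x - 0# ≡ x
    x-0≡x x = trans (cong (x +_) -0≡0) (+-identityʳ x)

    -- Squaring tʰ = -g₀ removes the sign, which places tˢ in H(q, r).
    tˢ≡g₀² : val t ^ s ≡ g₀ * g₀
    tˢ≡g₀² = begin
      val t ^ s               ≡⟨ cong (val t ^_) (trans (sym h*2≡s) (ℕ.*-comm h 2)) ⟩
      val t ^ (2 ℕ.* h)       ≡⟨ cong (λ k → val t ^ (h ℕ.+ k)) (ℕ.+-identityʳ h) ⟩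
      val t ^ (h ℕ.+ h)       ≡⟨ ^-distribˡ-+-* (val t) h h ⟩
      val t ^ h * val t ^ h   ≡⟨ cong₂ _*_ tʰ≡-g₀ tʰ≡-g₀ ⟩
      - g₀ * - g₀             ≡⟨ -‿distribˡ-* g₀ (- g₀) ⟨
      - (g₀ * - g₀)           ≡⟨ cong (λ x → - x) (-‿distribʳ-* g₀ g₀) ⟨
      - (- (g₀ * g₀))         ≡⟨ -‿involutive (g₀ * g₀) ⟩
      g₀ * g₀                 ∎
      where open ≡-Reasoning

    tˢʳ≡1 : (val t ^ s) ^ r ≡ 1#
    tˢʳ≡1 = trans (cong (_^ r) tˢ≡g₀²) (*-^≡1 r g₀ g₀ g₀ʳ≡1 g₀ʳ≡1)

    t∈tˡH⇒tʳ≡1 : Gpq p q r a t (0# , 0#) (1# , val t) → val t ^ r ≡ 1#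
    t∈tˡH⇒tʳ≡1 (l , 1≡aˡ , g , g∈H , t≡tˡg) = begin
      val t ^ r                  ≡⟨ cong (_^ r) (trans (sym (x-0≡x (val t))) (trans t≡tˡg (cong (_* g) (t^ᶻ l)))) ⟩
      (val t ^ k * g) ^ r        ≡⟨ *-^≡1 r (val t ^ k) g t^kʳ≡1 (𝔽q.H⇒^≡1 r g g∈H) ⟩
      1#                         ∎
      where
      open ≡-Reasoning
      k = exponent l

      -- Since `exponent` represents l for both units, the divisibility obtained from `a` applies to
      -- the power of `t`.
      s∣k : s ∣ k
      s∣k = order-∣ a k a-order (trans (sym (a^ᶻ l)) (trans (sym 1≡aˡ) (x-0≡x 1#)))

      t^kʳ≡1 : (val t ^ k) ^ r ≡ 1#
      t^kʳ≡1 with divides c k≡c*s ← s∣k = begin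
        (val t ^ k) ^ r           ≡⟨ cong (λ k → (val t ^ k) ^ r) (trans k≡c*s (ℕ.*-comm c s)) ⟩
        (val t ^ (s ℕ.* c)) ^ r   ≡⟨ cong (_^ r) (^-*-assoc (val t) s c) ⟨
        ((val t ^ s) ^ c) ^ r     ≡⟨ ^-^≡1 (val t ^ s) c r tˢʳ≡1 ⟩
        1#                        ∎

lemma4p13 : (p q : ℕ) .{{_ : NonZero p}} .{{_ : NonZero q}} →
    Prime p → Prime q → p < q →
    (s r : ℕ) → 2 ∣ s → s ∣ p ∸ 1 → r ∣ q ∸ 1 →
    (a : Units {p}) → H p s ≐ ⟨ a ⟩ →
    (t : Units {q}) → neg (H q r) (val t ^ (s / 2)) →
    (o : ℕ) → IsOrder t o →
    (u : ℕ) → u ≡ lcm r o →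
    IsSymmetricGraph (G p s ⊗ G q u)
    × (∃[ Δ ] (IsSpanningSubgraph Δ (G p s ⊗ G q u) × Gpq p q r a t ≅ Δ))
    × ((Gpq p q r a t ≅ G p s ⊗ G q u) ⇔ H q r (val t))
lemma4p13 p q p-prime q-prime _ s r 2∣s s∣p∸1 r∣q∸1 a H≐⟨a⟩ t tʰ∈-H o t-order _ refl =
  product-isSymmetric ,
  -- Both graphs have the same vertex set, so the subgraph is G(pq; r, s, u) itself.
  (Gpq p q r a t , Gpq-isSpanningSubgraph , identity (λ _ _ → mk⇔ id id)) ,
  mk⇔ ≅⇒t∈H (λ t∈H → identity (λ v w → mk⇔ (Gpq⇒product {v} {w}) (product⇒Gpq t∈H {v} {w})))
  where
  open PrimeProduct p-prime q-prime 2∣s s∣p∸1 r∣q∸1 a H≐⟨a⟩ t tʰ∈-H t-order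

  identity : ∀ {V : Set} {Γ Δ : Digraph V} → (∀ v w → Γ v w ⇔ Δ v w) → Γ ≅ Δ
  identity adjacent = record { bij = ↔-id _ ; adjacent = adjacent }
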